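{- For any graph $G$ we have $$\iota(G)\geq \left\lceil\frac{n(G)-\alpha_{\rm es}(G)}{\Delta(G)+1}\right\rceil.$$
   Context: All graphs are finite and simple; $n(G)$ is the number of vertices and $\Delta(G)$ the maximum degree of $G$. For $A\subseteq V(G)$, $N[A]=\bigcup_{a\in A}N[a]$ is the union of closed neighborhoods and $N(A)=N[A]- A$. A set $A\subseteq V(G)$ is an isolating set if $V(G)- N[A]$ is an independent set of $G$; the isolation number $\iota(G)$ is the minimum cardinality of an isolating set. A set $B\subseteq V(G)$ is an externally supported independence set (ESI-set) if $B$ is independent and every $v\in N(B)$ has a neighbor in $V(G)- N[B]$ (the empty set is an ESI-set). The externally supported independence number $\alpha_{\rm es}(G)$ is the maximum cardinality of an ESI-set of $G$. -}

module Defs where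

open import Data.Fin.Base using (Fin)
open import Data.Fin.Properties using (any?; all?)
open import Data.Fin.Subset
open import Data.Fin.Subset.Properties
open import Data.List.Base using (List; []; _∷_; [_]; _++_; map; filter; allFin)
open import Data.List.Extrema.Nat
  using (max; argmin; argmax; argmin-all; argmax-all;
         f[argmin]≤f[xs]; f[xs]≤f[argmax])
open import Data.List.Membership.Propositional using () renaming (_∈_ to _∈ᴸ_)
open import Data.List.Membership.Propositional.Properties
  using (∈-map⁺; ∈-++⁺ˡ; ∈-++⁺ʳ; ∈-filter⁺; ∈-allFin)
open import Data.List.Relation.Unary.All as All using ()
open import Data.List.Relation.Unary.All.Properties using (all-filter)
open import Data.List.Relation.Unary.Any using (here; there)
open import Data.Nat.Base using (ℕ; zero; suc; _≤_)
open import Data.List.Properties using (filter-none)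
open import Data.Product.Base using (∃-syntax; _×_; _,_)
open import Data.Sum.Base using (inj₁; inj₂)
open import Data.Vec.Base using ([]; _∷_; tabulate)
open import Level using (0ℓ)
open import Relation.Binary.Core using (Rel)
open import Relation.Binary.Definitions using (Symmetric; Irreflexive)
  renaming (Decidable to Decidable₂)
open import Relation.Binary.PropositionalEquality using (_≡_; refl; cong; subst)
open import Relation.Nullary using (¬_; does; contradiction; ¬?; _×-dec_; _→-dec_)
open import Relation.Unary using (Pred; Decidable)

-- Finite simple graphs, with vertices numbered.  Decidability of
-- adjacency is automatic classically and makes all parameters computable.
record Graph : Set₁ where
  field
    order  : ℕ
    Adj    : Rel (Fin order) 0ℓ
    sym    : Symmetric Adj
    irrefl : Irreflexive _≡_ Adj
    adj?   : Decidable₂ Adj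

  Vertex : Set
  Vertex = Fin order

  VertexSet : Set
  VertexSet = Subset order

open Graph public using (order; Vertex; VertexSet)

allSubsets : ∀ n → List (Subset n)
allSubsets zero    = [ [] ]
allSubsets (suc n) = map (inside ∷_) (allSubsets n) ++ map (outside ∷_) (allSubsets n)

∈-allSubsets : ∀ {n} (p : Subset n) → p ∈ᴸ allSubsets n
∈-allSubsets []            = here refl
∈-allSubsets (inside ∷ p)  = ∈-++⁺ˡ (∈-map⁺ (inside ∷_) (∈-allSubsets p))
∈-allSubsets {suc n} (outside ∷ p) =
  ∈-++⁺ʳ (map (inside ∷_) (allSubsets n)) (∈-map⁺ (outside ∷_) (∈-allSubsets p))

module _ (G : Graph) where
  open Graph G using (Adj; adj?)

  -- N(v)
  nbr : Vertex G → VertexSet G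
  nbr v = tabulate (λ u → does (adj? v u))

  -- N[v]
  nbr[_] : Vertex G → VertexSet G
  nbr[ v ] = ⁅ v ⁆ ∪ nbr v

  N[_] : VertexSet G → VertexSet G
  N[ A ] = ⋃ (map nbr[_] (filter (_∈? A) (allFin (order G))))

  N : VertexSet G → VertexSet G
  N A = N[ A ] ─ A

  degree : Vertex G → ℕ
  degree v = ∣ nbr v ∣

  -- The maximum degree, taken to be 0 for the graph without vertices.
  Δ : ℕ
  Δ = max 0 (map degree (allFin (order G)))

  Independent : Pred (VertexSet G) 0ℓ
  Independent S = ∀ u → u ∈ S → ∀ v → v ∈ S → ¬ Adj u v

  Isolating : Pred (VertexSet G) 0ℓ
  Isolating A = Independent (∁ N[ A ])

  ESI : Pred (VertexSet G) 0ℓ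
  ESI B = Independent B × (∀ v → v ∈ N B → ∃[ u ] (Adj v u × u ∈ ∁ N[ B ]))

  independent? : Decidable Independent
  independent? S =
    all? λ u → u ∈? S →-dec (all? λ v → v ∈? S →-dec ¬? (adj? u v))

  isolating? : Decidable Isolating
  isolating? A = independent? (∁ N[ A ])

  esi? : Decidable ESI
  esi? B = independent? B ×-dec
    (all? λ v → v ∈? N B →-dec (any? λ u → adj? v u ×-dec u ∈? ∁ N[ B ]))

  -- The default ⊤ is itself isolating, so this is a true minimum (see
  -- ι-attained and ι-minimum); likewise ⊥ is an ESI-set below.
  minIsolatingSet : VertexSet G
  minIsolatingSet = argmin ∣_∣ ⊤ (filter isolating? (allSubsets (order G)))

  ι : ℕ
  ι = ∣ minIsolatingSet ∣

  maxESISet : VertexSet G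
  maxESISet = argmax ∣_∣ ⊥ (filter esi? (allSubsets (order G)))

  αₑₛ : ℕ
  αₑₛ = ∣ maxESISet ∣

  private
    ⊆-⋃ : ∀ {n x} {p : Subset n} {ps} → p ∈ᴸ ps → x ∈ p → x ∈ ⋃ ps
    ⊆-⋃ {ps = q ∷ qs} (here refl)  x∈p = x∈p∪q⁺ (inj₁ x∈p)
    ⊆-⋃ {ps = q ∷ qs} (there p∈qs) x∈p = x∈p∪q⁺ (inj₂ (⊆-⋃ p∈qs x∈p))

    A⊆N[A] : ∀ A → A ⊆ N[ A ]
    A⊆N[A] A {x} x∈A =
      ⊆-⋃ (∈-map⁺ nbr[_] (∈-filter⁺ (_∈? A) (∈-allFin x) x∈A))
          (p⊆p∪q (nbr x) (x∈⁅x⁆ x))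

    N[⊥]≡⊥ : N[ ⊥ ] ≡ ⊥
    N[⊥]≡⊥ = cong (λ vs → ⋃ (map nbr[_] vs))
      (filter-none (_∈? ⊥) (All.universal (λ _ → ∉⊥) (allFin (order G))))

  ⊤-isolating : Isolating ⊤
  ⊤-isolating u u∈ _ _ _ = x∈∁p⇒x∉p u∈ (A⊆N[A] ⊤ ∈⊤)

  ⊥-esi : ESI ⊥
  ⊥-esi = (λ _ u∈⊥ → contradiction u∈⊥ ∉⊥)
        , (λ v v∈N → contradiction
            (subst (v ∈_) N[⊥]≡⊥ (p─q⊆p N[ ⊥ ] ⊥ v∈N)) ∉⊥)

  ι-attained : Isolating minIsolatingSet
  ι-attained = argmin-all ∣_∣ ⊤-isolating
    (all-filter isolating? (allSubsets (order G)))

  ι-minimum : ∀ A → Isolating A → ι ≤ ∣ A ∣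
  ι-minimum A isol = All.lookup
    (f[argmin]≤f[xs] ⊤ (filter isolating? (allSubsets (order G))))
    (∈-filter⁺ isolating? (∈-allSubsets A) isol)

  αₑₛ-attained : ESI maxESISet
  αₑₛ-attained = argmax-all ∣_∣ ⊥-esi
    (all-filter esi? (allSubsets (order G)))

  αₑₛ-maximum : ∀ B → ESI B → ∣ B ∣ ≤ αₑₛ
  αₑₛ-maximum B esi = All.lookup
    (f[xs]≤f[argmax] ⊥ (filter esi? (allSubsets (order G))))
    (∈-filter⁺ esi? (∈-allSubsets B) esi)

-- For an isolating set A, the independent set I = V(G) − N[A] is an ESI-set: a
-- vertex of N(I) lies in N[A] but not in A, so it has a neighbour in A, and no
-- vertex of A is in N[I].  Hence n(G) − αₑₛ(G) ≤ ∣N[A]∣ ≤ ∣A∣ (Δ(G) + 1).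
module Submission where

open import Defs
open import Data.Integer using (+_; _-_; _≥_)
open import Data.Nat using (suc)
open import Data.Rational using (_/_; ceiling)

open import Data.Bool.Base using (true; false)
open import Data.Fin.Base as Fin using (Fin)
open import Data.Fin.Subset
  using (Subset; inside; outside; _∈_; _∉_; ∣_∣; _∪_; _─_; ⋃; ∁; ⁅_⁆)
open import Data.Fin.Subset.Properties
import Data.Integer as ℤ
import Data.Integer.DivMod as ℤ
import Data.Integer.Properties as ℤ
open import Data.List.Base as List using (List; []; _∷_; length; filter; allFin)
open import Data.List.Extrema.Nat using (xs≤max)
open import Data.List.Membership.Propositional using (find; lose)
open import Data.List.Membership.Propositional.Properties
  using (∈-map⁺; ∈-filter⁺; ∈-filter⁻; ∈-allFin)
open import Data.List.Properties using (length-map)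
open import Data.List.Relation.Unary.All as All using (All; []; _∷_)
import Data.List.Relation.Unary.All.Properties as All
open import Data.List.Relation.Unary.Any as Any using (Any; here; there)
import Data.List.Relation.Unary.Any.Properties as Any
open import Data.Nat.Base as ℕ using (ℕ; zero; z≤n; s≤s)
import Data.Nat.Properties as ℕ
open import Data.Product.Base using (∃-syntax; _×_; _,_)
import Data.Rational.Base as ℚ
import Data.Rational.Properties as ℚ
open import Data.Rational.Unnormalised.Base as ℚᵘ using (mkℚᵘ; *≤*)
import Data.Rational.Unnormalised.Properties as ℚᵘ
open import Data.Sum.Base using (_⊎_; inj₁; inj₂)
open import Data.Vec.Base as Vec using ([]; _∷_; there)
open import Data.Vec.Properties using (lookup∘tabulate; []=⇒lookup; lookup⇒[]=)
open import Function.Base using (_∘_)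
open import Level using (0ℓ)
open import Relation.Binary.Core using (Rel)
open import Relation.Binary.PropositionalEquality
  using (_≡_; refl; sym; trans; cong; subst)
open import Relation.Nullary using (Dec; yes; does; contradiction)
open import Relation.Nullary.Decidable using (dec-true)
open import Relation.Unary using (Pred; Decidable)

private
  variable
    n : ℕ

-- Cardinalities of unions and of filtered vertex lists.

x∈p─q⇒x∉q : ∀ {x} {p q : Subset n} → x ∈ p ─ q → x ∉ q
x∈p─q⇒x∉q {p = _ ∷ _} (there x∈p─q) (there x∈q) = x∈p─q⇒x∉q x∈p─q x∈q

∣p∪q∣≤∣p∣+∣q∣ : ∀ (p q : Subset n) → ∣ p ∪ q ∣ ℕ.≤ ∣ p ∣ ℕ.+ ∣ q ∣
∣p∪q∣≤∣p∣+∣q∣ []            []            = z≤n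
∣p∪q∣≤∣p∣+∣q∣ (inside  ∷ p) (x       ∷ q) = s≤s (ℕ.≤-trans
  (∣p∪q∣≤∣p∣+∣q∣ p q) (ℕ.+-monoʳ-≤ ∣ p ∣ (∣p∣≤∣x∷p∣ x q)))
∣p∪q∣≤∣p∣+∣q∣ (outside ∷ p) (inside  ∷ q) = ℕ.≤-trans
  (s≤s (∣p∪q∣≤∣p∣+∣q∣ p q)) (ℕ.≤-reflexive (sym (ℕ.+-suc ∣ p ∣ ∣ q ∣)))
∣p∪q∣≤∣p∣+∣q∣ (outside ∷ p) (outside ∷ q) = ∣p∪q∣≤∣p∣+∣q∣ p q

∣⋃∣≤length* : ∀ {k} {ps : List (Subset n)} → All (λ p → ∣ p ∣ ℕ.≤ k) ps →
              ∣ ⋃ ps ∣ ℕ.≤ length ps ℕ.* k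
∣⋃∣≤length* {n = n} [] = ℕ.≤-reflexive (∣⊥∣≡0 n)
∣⋃∣≤length* {ps = p ∷ ps} (∣p∣≤k ∷ rest) =
  ℕ.≤-trans (∣p∪q∣≤∣p∣+∣q∣ p (⋃ ps)) (ℕ.+-mono-≤ ∣p∣≤k (∣⋃∣≤length* rest))

∈⋃⁻ : ∀ {x : Fin n} (ps : List (Subset n)) → x ∈ ⋃ ps → Any (x ∈_) ps
∈⋃⁻ []       x∈ = contradiction x∈ ∉⊥
∈⋃⁻ (p ∷ ps) x∈ with x∈p∪q⁻ p (⋃ ps) x∈
... | inj₁ x∈p  = here x∈p
... | inj₂ x∈ps = there (∈⋃⁻ ps x∈ps)

∈⋃⁺ : ∀ {x : Fin n} {ps : List (Subset n)} → Any (x ∈_) ps → x ∈ ⋃ ps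
∈⋃⁺ (here x∈p)   = x∈p∪q⁺ (inj₁ x∈p)
∈⋃⁺ (there x∈ps) = x∈p∪q⁺ (inj₂ (∈⋃⁺ x∈ps))

-- Stated for an arbitrary `f`, since the induction step replaces `f` by `f ∘ Fin.suc`. The case
-- needed is the identity, which gives `allFin`.
length-filter-tabulate :
  ∀ {a p} {A : Set a} {P : Pred A p} (P? : Decidable P) (f : Fin n → A) →
  length (filter P? (List.tabulate f)) ≡ ∣ Vec.tabulate (does ∘ P? ∘ f) ∣
length-filter-tabulate {n = zero}  P? f = refl
length-filter-tabulate {n = suc n} P? f with does (P? (f Fin.zero))
... | true  = cong suc (length-filter-tabulate P? (f ∘ Fin.suc))
... | false = length-filter-tabulate P? (f ∘ Fin.suc)

tabulate-∈? : ∀ (p : Subset n) → Vec.tabulate (λ i → does (i ∈? p)) ≡ p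
tabulate-∈? []            = refl
tabulate-∈? (inside  ∷ p) = cong (inside ∷_) (tabulate-∈? p)
tabulate-∈? (outside ∷ p) = cong (outside ∷_) (tabulate-∈? p)

-- `N[_]` is a union over a filtered list of vertices; this identifies the number of sets in that
-- union with the size of the set.
length-filter-∈? : ∀ (p : Subset n) → length (filter (_∈? p) (allFin n)) ≡ ∣ p ∣
length-filter-∈? p =
  trans (length-filter-tabulate (_∈? p) (λ i → i)) (cong ∣_∣ (tabulate-∈? p))

-- Upper bounds for ceilings of rationals.

-- With `q` the integer quotient, `j * ↧ p ≤ ↥ p < (1 + q) * ↧ p`; cancelling the positive
-- denominator gives `j < 1 + q`.
≤-floor : ∀ p j → j ℤ.* ℚ.↧ p ℤ.≤ ℚ.↥ p → j ℤ.≤ ℚ.floor p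
≤-floor p@(ℚ.mkℚ m k _) j j*k≤m = begin
  j                 ≤⟨ ℤ.i<j⇒i≤pred[j] j<suc[q] ⟩
  ℤ.pred (ℤ.suc q)  ≡⟨ ℤ.pred-suc q ⟩
  q                 ≡⟨ ℤ.div-pos-is-/ℕ m (suc k) ⟨
  ℚ.floor p         ∎
  where
  open ℤ.≤-Reasoning
  q = m ℤ./ℕ suc k
  j<suc[q] : j ℤ.< ℤ.suc q
  j<suc[q] = ℤ.*-cancelʳ-<-nonNeg (+ suc k)
    (ℤ.≤-<-trans j*k≤m (ℤ.n<s[n/ℕd]*d m (suc k)))

-- The ceiling is by definition `- floor (- p)`, so the floor bound applies to `- p` and `- i`.
ceiling-≤ : ∀ p i → ℚ.↥ p ℤ.≤ i ℤ.* ℚ.↧ p → ceiling p ℤ.≤ i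
ceiling-≤ p@(ℚ.mkℚ _ _ _) i m≤i*k = begin
  ℤ.- ℚ.floor (ℚ.- p)  ≤⟨ ℤ.neg-mono-≤ (≤-floor (ℚ.- p) (ℤ.- i) -i*k≤-m) ⟩
  ℤ.- ℤ.- i            ≡⟨ ℤ.neg-involutive i ⟩
  i                    ∎
  where
  open ℤ.≤-Reasoning
  -i*k≤-m : ℤ.- i ℤ.* ℚ.↧ (ℚ.- p) ℤ.≤ ℚ.↥ (ℚ.- p)
  -i*k≤-m = begin
    ℤ.- i ℤ.* ℚ.↧ (ℚ.- p)  ≡⟨ cong (ℤ.- i ℤ.*_) (ℚ.↧-neg p) ⟩
    ℤ.- i ℤ.* ℚ.↧ p        ≡⟨ ℤ.neg-distribˡ-* i (ℚ.↧ p) ⟨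
    ℤ.- (i ℤ.* ℚ.↧ p)      ≤⟨ ℤ.neg-mono-≤ m≤i*k ⟩
    ℤ.- ℚ.↥ p              ≡⟨ ℚ.↥-neg p ⟨
    ℚ.↥ (ℚ.- p)            ∎

-- `z / suc d` is put in lowest terms, so its numerator and denominator need not be `z` and `suc d`.
-- The inequality is therefore carried over through unnormalised fractions.
ceiling-/-≤ : ∀ {z i} d → z ℤ.≤ i ℤ.* + suc d → ceiling (z / suc d) ℤ.≤ i
ceiling-/-≤ {z} {i} d z≤i*d = ceiling-≤ p i (begin
  ℚ.↥ p           ≡⟨ ℚ.↥ᵘ-toℚᵘ p ⟨
  ℚᵘ.↥ q          ≡⟨ ℤ.*-identityʳ (ℚᵘ.↥ q) ⟨
  ℚᵘ.↥ q ℤ.* + 1  ≤⟨ ℚᵘ.drop-*≤* q≤i ⟩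
  i ℤ.* ℚᵘ.↧ q    ≡⟨ cong (i ℤ.*_) (ℚ.↧ᵘ-toℚᵘ p) ⟩
  i ℤ.* ℚ.↧ p     ∎)
  where
  open ℤ.≤-Reasoning
  p = z / suc d
  q = ℚ.toℚᵘ p
  q≤i : q ℚᵘ.≤ mkℚᵘ i 0
  -- `mkℚᵘ` stores the denominator minus one: `mkℚᵘ z d` is z/(d+1) and `mkℚᵘ i 0` is i/1.
  q≤i = ℚᵘ.≤-respˡ-≃ (ℚᵘ.≃-sym (ℚ.toℚᵘ-fromℚᵘ (mkℚᵘ z d)))
    (*≤* (ℤ.≤-trans (ℤ.≤-reflexive (ℤ.*-identityʳ z)) z≤i*d))

m≤n+o⇒m-n≤o : ∀ m n {o} → m ℕ.≤ n ℕ.+ o → + m - + n ℤ.≤ + o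
m≤n+o⇒m-n≤o m n {o} m≤n+o = begin
  + m - + n            ≡⟨ ℤ.m-n≡m⊖n m n ⟩
  m ℤ.⊖ n              ≤⟨ ℤ.⊖-monoˡ-≤ n m≤n+o ⟩
  (n ℕ.+ o) ℤ.⊖ n      ≡⟨ ℤ.⊖-≥ (ℕ.m≤m+n n o) ⟩
  + ((n ℕ.+ o) ℕ.∸ n)  ≡⟨ cong +_ (ℕ.m+n∸m≡n n o) ⟩
  + o                  ∎
  where open ℤ.≤-Reasoning

-- Closed neighbourhoods and isolating sets.

module _ (G : Graph) where
  open Graph G using (Adj; adj?)

  infix 4 _≈_

  -- Joining equality with adjacency makes membership in a closed neighbourhood a symmetric
  -- relation.
  _≈_ : Rel (Vertex G) 0ℓ
  u ≈ v = u ≡ v ⊎ Adj u v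

  ≈-sym : ∀ {u v} → u ≈ v → v ≈ u
  ≈-sym (inj₁ u≡v) = inj₁ (sym u≡v)
  ≈-sym (inj₂ u~v) = inj₂ (Graph.sym G u~v)

  ∈nbr⁺ : ∀ {u v} → Adj v u → u ∈ nbr G v
  ∈nbr⁺ {u} {v} v~u = lookup⇒[]= u (nbr G v)
    (trans (lookup∘tabulate _ u) (dec-true (adj? v u) v~u))

  ∈nbr⁻ : ∀ {u v} → u ∈ nbr G v → Adj v u
  ∈nbr⁻ {u} {v} u∈ = does-≡-true (adj? v u)
    (trans (sym (lookup∘tabulate _ u)) ([]=⇒lookup u∈))
    where
    does-≡-true : ∀ {A : Set} (a? : Dec A) → does a? ≡ true → A
    does-≡-true (yes a) _ = a

  ∈nbr[]⁺ : ∀ {u v} → v ≈ u → u ∈ nbr[_] G v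
  ∈nbr[]⁺ {u} (inj₁ refl) = x∈p∪q⁺ (inj₁ (x∈⁅x⁆ u))
  ∈nbr[]⁺     (inj₂ v~u)  = x∈p∪q⁺ (inj₂ (∈nbr⁺ v~u))

  ∈nbr[]⁻ : ∀ {u v} → u ∈ nbr[_] G v → v ≈ u
  ∈nbr[]⁻ {u} {v} u∈ with x∈p∪q⁻ ⁅ v ⁆ (nbr G v) u∈
  ... | inj₁ u∈⁅v⁆ = inj₁ (sym (x∈⁅y⁆⇒x≡y v u∈⁅v⁆))
  ... | inj₂ u∈nbr = inj₂ (∈nbr⁻ u∈nbr)

  ∈N[]⁺ : ∀ {A u v} → v ∈ A → v ≈ u → u ∈ N[_] G A
  ∈N[]⁺ {A} {u} {v} v∈A v≈u = ∈⋃⁺ (Any.map⁺ (lose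
    (∈-filter⁺ (_∈? A) (∈-allFin v) v∈A) (∈nbr[]⁺ v≈u)))

  ∈N[]⁻ : ∀ {A u} → u ∈ N[_] G A → ∃[ v ] (v ∈ A × v ≈ u)
  ∈N[]⁻ {A} u∈ with find (Any.map⁻ (∈⋃⁻ _ u∈))
  ... | v , v∈filter , u∈nbr[v] with ∈-filter⁻ (_∈? A) {xs = allFin _} v∈filter
  ...   | _ , v∈A = v , v∈A , ∈nbr[]⁻ u∈nbr[v]

  ∣nbr[v]∣≤1+Δ : ∀ v → ∣ nbr[_] G v ∣ ℕ.≤ suc (Δ G)
  ∣nbr[v]∣≤1+Δ v = begin
    ∣ ⁅ v ⁆ ∪ nbr G v ∣       ≤⟨ ∣p∪q∣≤∣p∣+∣q∣ ⁅ v ⁆ (nbr G v) ⟩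
    ∣ ⁅ v ⁆ ∣ ℕ.+ degree G v  ≡⟨ cong (ℕ._+ degree G v) (∣⁅x⁆∣≡1 v) ⟩
    suc (degree G v)          ≤⟨ s≤s (All.lookup (xs≤max 0 degrees)
                                  (∈-map⁺ (degree G) (∈-allFin v))) ⟩
    suc (Δ G)                 ∎
    where
    open ℕ.≤-Reasoning
    degrees = List.map (degree G) (allFin (order G))

  ∣N[A]∣≤∣A∣*[1+Δ] : ∀ A → ∣ N[_] G A ∣ ℕ.≤ ∣ A ∣ ℕ.* suc (Δ G)
  ∣N[A]∣≤∣A∣*[1+Δ] A = begin
    ∣ N[_] G A ∣                                   ≤⟨ ∣⋃∣≤length* (All.map⁺ (All.universal ∣nbr[v]∣≤1+Δ vs)) ⟩
    length (List.map (nbr[_] G) vs) ℕ.* suc (Δ G)  ≡⟨ cong (ℕ._* suc (Δ G)) (length-map (nbr[_] G) vs) ⟩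
    length vs ℕ.* suc (Δ G)                        ≡⟨ cong (ℕ._* suc (Δ G)) (length-filter-∈? A) ⟩
    ∣ A ∣ ℕ.* suc (Δ G)                            ∎
    where
    open ℕ.≤-Reasoning
    vs = filter (_∈? A) (allFin (order G))

  isolating⇒∁N[]-esi : ∀ {A} → Isolating G A → ESI G (∁ (N[_] G A))
  -- Independence of the complement is the definition of `Isolating`.
  isolating⇒∁N[]-esi {A} isolating = isolating , supported
    where
    I = ∁ (N[_] G A)

    A⊆∁N[I] : ∀ {a} → a ∈ A → a ∈ ∁ (N[_] G I)
    -- A vertex `i` of `I` with `i ≈ a` would, by symmetry, lie in `N[ A ]`.
    A⊆∁N[I] a∈A = x∉p⇒x∈∁p λ a∈N[I] → let (i , i∈I , i≈a) = ∈N[]⁻ a∈N[I] in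
      x∈∁p⇒x∉p i∈I (∈N[]⁺ a∈A (≈-sym i≈a))

    supported : ∀ v → v ∈ N G I → ∃[ u ] (Adj v u × u ∈ ∁ (N[_] G I))
    supported v v∈N with ∈N[]⁻ (x∉∁p⇒x∈p (x∈p─q⇒x∉q v∈N))
    -- Here `v` is itself in `A`, yet `v` lies in `N[ I ]`, which misses `A`.
    ... | a , a∈A , inj₁ refl =
      contradiction (p─q⊆p (N[_] G I) I v∈N) (x∈∁p⇒x∉p (A⊆∁N[I] a∈A))
    -- The supporting neighbour of `v` is the vertex of `A` that dominates it.
    ... | a , a∈A , inj₂ a~v  = a , Graph.sym G a~v , A⊆∁N[I] a∈A

  -- The vertices split into the complement of `N[ A ]`, an ESI-set, and `N[ A ]`, bounded by the
  -- union bound. The additive form avoids truncated subtraction.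
  isolating-bound : ∀ {A} → Isolating G A → order G ℕ.≤ αₑₛ G ℕ.+ ∣ A ∣ ℕ.* suc (Δ G)
  isolating-bound {A} isolating = begin
    order G                                    ≡⟨ ℕ.m∸n+n≡m (∣p∣≤n (N[_] G A)) ⟨
    order G ℕ.∸ ∣ N[_] G A ∣ ℕ.+ ∣ N[_] G A ∣  ≡⟨ cong (ℕ._+ ∣ N[_] G A ∣) (∣∁p∣≡n∸∣p∣ (N[_] G A)) ⟨
    ∣ ∁ (N[_] G A) ∣ ℕ.+ ∣ N[_] G A ∣          ≤⟨ ℕ.+-mono-≤ (αₑₛ-maximum G _ (isolating⇒∁N[]-esi isolating))
                                                             (∣N[A]∣≤∣A∣*[1+Δ] A) ⟩
    αₑₛ G ℕ.+ ∣ A ∣ ℕ.* suc (Δ G)              ∎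
    where open ℕ.≤-Reasoning

theorem1 : (G : Graph) →
    + ι G ≥ ceiling ((+ order G - + αₑₛ G) / suc (Δ G))
theorem1 G = ceiling-/-≤ (Δ G)
  -- The bound for a minimum isolating set is a product in ℕ; `ℤ.pos-*` turns it into the integer
  -- product that `ceiling-/-≤` expects.
  (subst (+ order G - + αₑₛ G ℤ.≤_) (ℤ.pos-* (ι G) (suc (Δ G)))
    (m≤n+o⇒m-n≤o (order G) (αₑₛ G) (isolating-bound G (ι-attained G))))
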